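{- A subset of $\mathbb{R}_{\max}^n$ is a tropical polyhedron with mixed constraints if, and only if, it is the intersection of finitely many tropical hemispaces of $\mathbb{R}_{\max}^n$.
   Context: $\mathbb{R}_{\max}=\mathbb{R}\cup\{ -\infty\}$ is the max-plus semiring ($x\oplus y=\max(x,y)$, $x\otimes y=xy=x+y$), and $\overline{\mathbb{R}}_{\max}=\mathbb{R}_{\max}\cup\{+\infty\}$. Let $\mathbb{R}^-=\{\alpha^-:\alpha\in\mathbb{R}\}$ be a disjoint copy of $\mathbb{R}$ and $\mathbb{G}=\overline{\mathbb{R}}_{\max}\cup\mathbb{R}^-$. The modulus is $|x|=x$ for $x\in\overline{\mathbb{R}}_{\max}$ and $|\alpha^-|=\alpha$. The total order $\leq_{\mathbb{G}}$ is: $x\leq_{\mathbb{G}}y$ iff $|x|<|y|$ when $x\in\overline{\mathbb{R}}_{\max}$ and $y\in\mathbb{R}^-$, and $|x|\le|y|$ in all other cases. $\mathbb{G}$ is a semiring where $x\oplus y$ is the greater of $x,y$ for $\leq_{\mathbb{G}}$, and $xy$ is: $x+y$ if $x,y\in\mathbb{R}$; $(|x|+|y|)^-$ if $x\in\mathbb{R}^-$ or $y\in\mathbb{R}^-$ and both are different from $\pm\infty$; $-\infty$ if $x=-\infty$ or $y=-\infty$; $+\infty$ if neither is $-\infty$ and at least one is $+\infty$. A mixed tropical affine inequality is a constraint $a_0\oplus a_1\mathbf{x}_1\oplus\cdots\oplus a_n\mathbf{x}_n\leq_{\mathbb{G}}b_0\oplus b_1\mathbf{x}_1\oplus\cdots\oplus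 b_n\mathbf{x}_n$ with $a_i\in\mathbb{R}_{\max}$ and $b_i\in\mathbb{G}$. A tropical polyhedron with mixed constraints is the set of $\mathbf{x}\in\mathbb{R}_{\max}^n$ satisfying finitely many mixed tropical affine inequalities. A subset $\mathcal{C}\subset\mathbb{R}_{\max}^n$ is tropically convex if $\lambda\mathbf{x}\oplus\mu\mathbf{y}\in\mathcal{C}$ for all $\mathbf{x},\mathbf{y}\in\mathcal{C}$ and $\lambda,\mu\in\mathbb{R}_{\max}$ with $\lambda\oplus\mu=0$. A tropical hemispace is a tropically convex set whose complement in $\mathbb{R}_{\max}^n$ is also tropically convex. -}

module Defs where

open import Algebra.Bundles using (CommutativeRing)
open import Data.List.Base using (List)
open import Data.List.Relation.Unary.All using (All)
open import Data.Nat.Base using (ℕ)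
open import Data.Product.Base using (∃; _×_; _,_; proj₁)
open import Data.Sum.Base using (_⊎_; inj₁; inj₂)
open import Data.Vec.Functional using (Vector; foldr; zipWith; map)
import Data.Vec.Functional.Relation.Binary.Pointwise as Vector
open import Function.Bundles using (_⇔_)
open import Level using (0ℓ)
open import Relation.Binary.Bundles using (TotalOrder)
open import Relation.Binary.Core using (Rel)
open import Relation.Binary.Definitions using (_Respects_; tri<; tri≈; tri>)
open import Relation.Binary.Structures
  using (IsEquivalence; IsDecTotalOrder; IsTotalOrder)
open import Relation.Nullary using (¬_; contradiction)
open import Relation.Nullary.Construct.Add.Extrema using (_±; ⊥±; ⊤±; [_])
open import Relation.Nullary.Construct.Add.Infimum
  using (_₋) renaming (⊥₋ to -∞; [_] to fin)
import Relation.Nullary.Construct.Add.Supremum as Supremum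
open import Relation.Unary using (Pred; _∈_; ∁)

import Algebra.Construct.NaturalChoice.Max as Max
import Relation.Binary.Construct.Add.Extrema.Equality as ExtremaEquality
import Relation.Binary.Construct.Add.Extrema.NonStrict as ExtremaOrder
import Relation.Binary.Construct.Add.Infimum.Equality as InfimumEquality
import Relation.Binary.Construct.Add.Infimum.NonStrict as InfimumOrder
import Relation.Binary.Construct.NonStrictToStrict as ToStrict

-- The real numbers, characterised up to isomorphism as the Dedekind-complete
-- ordered field.  Decidability of the order is no restriction in the presence
-- of excluded middle.  In that setting predicates at level 0ℓ also exhaust
-- all subsets, so that the supremum axiom is the usual one.
record RealField : Set₁ where
  field
    commutativeRing : CommutativeRing 0ℓ 0ℓ

  open CommutativeRing commutativeRing public
    renaming (Carrier to ℝ)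

  infix 4 _≤_

  field
    0≉1             : ¬ 0# ≈ 1#
    inverse         : ∀ x → ¬ x ≈ 0# → ∃ λ y → x * y ≈ 1#
    _≤_             : Rel ℝ 0ℓ
    isDecTotalOrder : IsDecTotalOrder _≈_ _≤_
    +-monoˡ-≤       : ∀ {x y} z → x ≤ y → x + z ≤ y + z
    *-nonNegative   : ∀ {x y} → 0# ≤ x → 0# ≤ y → 0# ≤ x * y

  UpperBound : Pred ℝ 0ℓ → Pred ℝ 0ℓ
  UpperBound P u = ∀ x → x ∈ P → x ≤ u

  field
    supremum : ∀ (P : Pred ℝ 0ℓ) → ∃ P → ∃ (UpperBound P) →
               ∃ λ s → UpperBound P s × (∀ u → UpperBound P u → s ≤ u)

module Tropical (realField : RealField) where

  open RealField realField
    hiding (isEquivalence; refl; sym; trans; reflexive)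
  private module ≤ℝ = IsDecTotalOrder isDecTotalOrder

  ℝmax : Set
  ℝmax = ℝ ₋

  ℝmax-totalOrder : TotalOrder 0ℓ 0ℓ 0ℓ
  ℝmax-totalOrder = record
    { isTotalOrder = InfimumOrder.≤₋-isTotalOrder _≤_ ≤ℝ.isTotalOrder }

  open InfimumEquality _≈_ public using (_≈₋_)
  open Max ℝmax-totalOrder public using () renaming (_⊔_ to infixl 6 _⊕_)

  infixl 7 _⊗_

  _⊗_ : ℝmax → ℝmax → ℝmax
  -∞    ⊗ y     = -∞
  fin x ⊗ -∞    = -∞
  fin x ⊗ fin y = fin (x + y)

  ℝ̄max : Set
  ℝ̄max = ℝ ±

  open ExtremaEquality _≈_ public using (_≈±_)
  open ExtremaOrder _≤_ public using (_≤±_)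
  open ToStrict _≈±_ _≤±_ public using () renaming (_<_ to infix 4 _<±_)

  private
    ≤±-isDecTotalOrder : IsDecTotalOrder _≈±_ _≤±_
    ≤±-isDecTotalOrder = ExtremaOrder.≤±-isDecTotalOrder _≤_ isDecTotalOrder

    module ≤± = IsDecTotalOrder ≤±-isDecTotalOrder
    module <± = ToStrict _≈±_ _≤±_

  infix 8 _⁻

  data 𝔾 : Set where
    ext : ℝ̄max → 𝔾
    _⁻  : ℝ → 𝔾

  ι : ℝmax → 𝔾
  ι x = ext Supremum.[ x ]

  ∣_∣ : 𝔾 → ℝ̄max
  ∣ ext x ∣ = x
  ∣ α ⁻ ∣   = [ α ]

  infix 4 _≈𝔾_ _≤𝔾_

  data _≈𝔾_ : Rel 𝔾 0ℓ where
    ext : ∀ {x y} → x ≈± y → ext x ≈𝔾 ext y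
    neg : ∀ {α β} → α ≈ β → α ⁻ ≈𝔾 β ⁻

  data _≤𝔾_ : Rel 𝔾 0ℓ where
    ext<neg : ∀ {x β} → ∣ ext x ∣ <± ∣ β ⁻ ∣   → ext x ≤𝔾 β ⁻
    ext≤ext : ∀ {x y} → ∣ ext x ∣ ≤± ∣ ext y ∣ → ext x ≤𝔾 ext y
    neg≤    : ∀ {α y} → ∣ α ⁻ ∣   ≤± ∣ y ∣     → α ⁻ ≤𝔾 y

  private
    ≈𝔾-isEquivalence : IsEquivalence _≈𝔾_
    ≈𝔾-isEquivalence = record
      { refl  = λ { {ext x} → ext ≤±.Eq.refl ; {α ⁻} → neg ≤ℝ.Eq.refl }
      ; sym   = λ { (ext p) → ext (≤±.Eq.sym p) ; (neg p) → neg (≤ℝ.Eq.sym p) }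
      ; trans = λ { (ext p) (ext q) → ext (≤±.Eq.trans p q)
                  ; (neg p) (neg q) → neg (≤ℝ.Eq.trans p q) }
      }

    ≤𝔾-reflexive : ∀ {x y} → x ≈𝔾 y → x ≤𝔾 y
    ≤𝔾-reflexive (ext p) = ext≤ext (≤±.reflexive p)
    ≤𝔾-reflexive (neg p) = neg≤ (ExtremaOrder.[ ≤ℝ.reflexive p ])

    ≤𝔾⇒≤± : ∀ {x y} → x ≤𝔾 y → ∣ x ∣ ≤± ∣ y ∣
    ≤𝔾⇒≤± (ext<neg p) = proj₁ p
    ≤𝔾⇒≤± (ext≤ext p) = p
    ≤𝔾⇒≤± (neg≤ p)    = p

    ≤𝔾-trans : ∀ {x y z} → x ≤𝔾 y → y ≤𝔾 z → x ≤𝔾 z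
    ≤𝔾-trans (neg≤ p) q = neg≤ (≤±.trans p (≤𝔾⇒≤± q))
    ≤𝔾-trans (ext≤ext p) (ext≤ext q) = ext≤ext (≤±.trans p q)
    ≤𝔾-trans (ext≤ext p) (ext<neg q) =
      ext<neg (<±.≤-<-trans ≤±.trans ≤±.antisym ≤±.≤-respˡ-≈ p q)
    ≤𝔾-trans {z = ext _} (ext<neg p) (neg≤ q) = ext≤ext (≤±.trans (proj₁ p) q)
    ≤𝔾-trans {z = _ ⁻} (ext<neg p) (neg≤ q) =
      ext<neg (<±.<-≤-trans ≤±.Eq.sym ≤±.trans ≤±.antisym ≤±.≤-respʳ-≈ p q)

    ≤𝔾-antisym : ∀ {x y} → x ≤𝔾 y → y ≤𝔾 x → x ≈𝔾 y
    ≤𝔾-antisym (ext<neg p) (neg≤ q) =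
      contradiction q (<±.<⇒≱ ≤±.antisym p)
    ≤𝔾-antisym (ext≤ext p) (ext≤ext q) = ext (≤±.antisym p q)
    ≤𝔾-antisym (neg≤ p) (ext<neg q) =
      contradiction p (<±.<⇒≱ ≤±.antisym q)
    ≤𝔾-antisym (neg≤ p) (neg≤ q) =
      neg (ExtremaEquality.[≈]-injective _≈_ (≤±.antisym p q))

    ≤𝔾-total : ∀ x y → x ≤𝔾 y ⊎ y ≤𝔾 x
    ≤𝔾-total (ext x) (ext y) with ≤±.total x y
    ... | inj₁ p = inj₁ (ext≤ext p)
    ... | inj₂ p = inj₂ (ext≤ext p)
    ≤𝔾-total (α ⁻) (β ⁻) with ≤±.total [ α ] [ β ]
    ... | inj₁ p = inj₁ (neg≤ p)
    ... | inj₂ p = inj₂ (neg≤ p)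
    ≤𝔾-total (ext x) (β ⁻)
      with <±.<-trichotomous ≤±.Eq.sym ≤±._≟_ ≤±.antisym ≤±.total x [ β ]
    ... | tri< p _ _ = inj₁ (ext<neg p)
    ... | tri≈ _ p _ = inj₂ (neg≤ (≤±.reflexive (≤±.Eq.sym p)))
    ... | tri> _ _ p = inj₂ (neg≤ (proj₁ p))
    ≤𝔾-total (α ⁻) (ext y)
      with <±.<-trichotomous ≤±.Eq.sym ≤±._≟_ ≤±.antisym ≤±.total y [ α ]
    ... | tri< p _ _ = inj₂ (ext<neg p)
    ... | tri≈ _ p _ = inj₁ (neg≤ (≤±.reflexive (≤±.Eq.sym p)))
    ... | tri> _ _ p = inj₁ (neg≤ (proj₁ p))

  𝔾-totalOrder : TotalOrder 0ℓ 0ℓ 0ℓ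
  𝔾-totalOrder = record
    { Carrier      = 𝔾
    ; _≈_          = _≈𝔾_
    ; _≤_          = _≤𝔾_
    ; isTotalOrder = record
      { isPartialOrder = record
        { isPreorder = record
          { isEquivalence = ≈𝔾-isEquivalence
          ; reflexive     = ≤𝔾-reflexive
          ; trans         = ≤𝔾-trans
          }
        ; antisym = ≤𝔾-antisym
        }
      ; total = ≤𝔾-total
      }
    }

  open Max 𝔾-totalOrder public using () renaming (_⊔_ to infixl 6 _⊕𝔾_)

  infixl 7 _⊗𝔾_

  _⊗𝔾_ : 𝔾 → 𝔾 → 𝔾
  ext ⊥±    ⊗𝔾 y         = ext ⊥±
  ext [ x ] ⊗𝔾 ext ⊥±    = ext ⊥±
  ext [ x ] ⊗𝔾 ext [ y ] = ext [ x + y ]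
  ext [ x ] ⊗𝔾 ext ⊤±    = ext ⊤±
  ext [ x ] ⊗𝔾 (y ⁻)     = (x + y) ⁻
  ext ⊤±    ⊗𝔾 ext ⊥±    = ext ⊥±
  ext ⊤±    ⊗𝔾 ext [ y ] = ext ⊤±
  ext ⊤±    ⊗𝔾 ext ⊤±    = ext ⊤±
  ext ⊤±    ⊗𝔾 (y ⁻)     = ext ⊤±
  (x ⁻)     ⊗𝔾 ext ⊥±    = ext ⊥±
  (x ⁻)     ⊗𝔾 ext [ y ] = (x + y) ⁻
  (x ⁻)     ⊗𝔾 ext ⊤±    = ext ⊤±
  (x ⁻)     ⊗𝔾 (y ⁻)     = (x + y) ⁻

  Point : ℕ → Set
  Point n = Vector ℝmax n

  _≋_ : ∀ {n} → Rel (Point n) 0ℓ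
  _≋_ = Vector.Pointwise _≈₋_

  -- ℝ carries a setoid equality, so a subset must be closed under it.
  record Subset (n : ℕ) : Set₁ where
    field
      pred : Pred (Point n) 0ℓ
      resp : pred Respects _≋_

  open Subset public

  affine : ∀ {n} → 𝔾 → Vector 𝔾 n → Point n → 𝔾
  affine c₀ c x = c₀ ⊕𝔾 foldr _⊕𝔾_ (ι -∞) (zipWith _⊗𝔾_ c (map ι x))

  record MixedInequality (n : ℕ) : Set where
    field
      a₀ : ℝmax
      a  : Vector ℝmax n
      b₀ : 𝔾
      b  : Vector 𝔾 n

  Satisfies : ∀ {n} → Point n → MixedInequality n → Set
  Satisfies x e = affine (ι a₀) (map ι a) x ≤𝔾 affine b₀ b x
    where open MixedInequality e

  IsMixedPolyhedron : ∀ {n} → Subset n → Set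
  IsMixedPolyhedron {n} C =
    ∃ λ (es : List (MixedInequality n)) →
      ∀ x → x ∈ pred C ⇔ All (Satisfies x) es

  Convex : ∀ {n} → Pred (Point n) 0ℓ → Set
  Convex C = ∀ x y → x ∈ C → y ∈ C →
             ∀ λ′ μ → λ′ ⊕ μ ≈₋ fin 0# →
             zipWith _⊕_ (map (λ′ ⊗_) x) (map (μ ⊗_) y) ∈ C

  IsHemispace : ∀ {n} → Subset n → Set
  IsHemispace C = Convex (pred C) × Convex (∁ (pred C))

  IsHemispaceIntersection : ∀ {n} → Subset n → Set₁
  IsHemispaceIntersection {n} C =
    ∃ λ (Hs : List (Subset n)) →
      All IsHemispace Hs × (∀ x → x ∈ pred C ⇔ All (λ H → x ∈ pred H) Hs)

{-# OPTIONS --safe #-}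

-- Homogenise: a hemispace of ℝmaxⁿ is the slice z₀ = 0 of a set A ⊆ ℝmaxⁿ⁺¹ such that A
-- and its complement are closed under ⊕ and finite scaling.  Each z is the sum of the
-- vectors zᵢeᵢ ⊕ zⱼeⱼ over i for any fixed j, and also the sum over j of vectors
-- zᵢeᵢ ⊕ zⱼeⱼ for any choice of i = i(j).  Hence z ∈ A if and only if every j with
-- zⱼ ≠ −∞ admits an i with zᵢeᵢ ⊕ zⱼeⱼ ∈ A.  Unless eⱼ ∈ A, when j imposes no constraint,
-- the admissible zⱼ − zᵢ form a down-set of ℝ, so the condition on the pair reads
-- zⱼ ≤ bⱼᵢ zᵢ for some bⱼᵢ in 𝔾, and the condition at j is one mixed inequality.
--
-- Conversely, a mixed inequality is the conjunction over i of the conditions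
-- "aᵢ xᵢ ≤ bₖ xₖ for some k", each of which defines a hemispace.

module Submission where

open import Defs
open import Axiom.ExcludedMiddle using (ExcludedMiddle)
open import Data.Nat.Base using (ℕ)
open import Function.Bundles using (_⇔_)

open import Data.Empty using (⊥)
open import Data.Fin.Base using (Fin; zero; suc)
open import Data.Fin.Properties using (_≟_)
open import Data.List.Base using (tabulate; _++_) renaming ([] to []ₗ; _∷_ to _∷ₗ_)
open import Data.List.Relation.Unary.All using (All; []; _∷_; universal)
import Data.List.Relation.Unary.All.Properties as All
open import Data.Nat.Base using (zero; suc)
open import Data.Product.Base using (∃; ∃-syntax; _×_; _,_; proj₁; proj₂)
open import Data.Sum.Base using (_⊎_; inj₁; inj₂; map₂; [_,_]′)
open import Data.Unit.Base using (⊤; tt)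
open import Data.Vec.Functional using (Vector; foldr; head; tail; replicate; updateAt)
  renaming (_∷_ to infixr 5 _∷ᵥ_)
open import Data.Vec.Functional.Properties using (updateAt-updates; updateAt-minimal)
open import Function.Base using (_∘_; const; id)
open import Function.Bundles using (mk⇔; module Equivalence)
open import Function.Construct.Composition using (_⇔-∘_)
open import Level using (0ℓ)
open import Relation.Binary.Bundles using (TotalOrder)
open import Relation.Binary.Definitions using (_Respects_)
open import Relation.Binary.PropositionalEquality.Core as ≡ using (_≡_)
open import Relation.Binary.Structures using (IsDecTotalOrder)
open import Relation.Nullary using (¬_; yes; no; contradiction)
open import Relation.Nullary.Construct.Add.Extrema using (⊥±; ⊤±; [_])
open import Relation.Nullary.Construct.Add.Infimum using () renaming (⊥₋ to -∞; [_] to fin)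
open import Relation.Nullary.Decidable.Core using (decidable-stable)
open import Relation.Unary using (Pred; _∈_; _∉_; ∁)

import Algebra.Construct.NaturalChoice.Max as Max
import Algebra.Properties.CommutativeSemigroup as CommutativeSemigroupProperties
import Algebra.Properties.Group as GroupProperties
import Relation.Binary.Construct.Add.Extrema.Equality as ExtremaEquality
import Relation.Binary.Construct.Add.Extrema.NonStrict as ExtremaOrder
import Relation.Binary.Construct.Add.Infimum.Equality as InfimumEquality
import Relation.Binary.Construct.Add.Infimum.NonStrict as InfimumOrder
import Relation.Binary.Construct.Add.Supremum.Equality as SupremumEquality
import Relation.Binary.Construct.Add.Supremum.NonStrict as SupremumOrder

open Equivalence using (to; from)

-- Comparison with finite maxima in a total order.

module MaxFold {c ℓ₁ ℓ₂} (O : TotalOrder c ℓ₁ ℓ₂) where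

  open TotalOrder O renaming (Carrier to A)
  open Max O

  x≤y⊔z⇒x≤y⊎x≤z : ∀ {x y z} → x ≤ y ⊔ z → x ≤ y ⊎ x ≤ z
  x≤y⊔z⇒x≤y⊎x≤z {x} {y} {z} p =
    [ (λ q → inj₁ (≤-respʳ-≈ q p)) , (λ q → inj₂ (≤-respʳ-≈ q p)) ]′ (⊔-sel y z)

  ≤-foldr⁻ : ∀ {n x} e (f : Vector A n) → x ≤ foldr _⊔_ e f → x ≤ e ⊎ ∃[ i ] x ≤ f i
  ≤-foldr⁻ {zero}  e f p = inj₁ p
  ≤-foldr⁻ {suc n} e f p with x≤y⊔z⇒x≤y⊎x≤z p
  ... | inj₁ q = inj₂ (zero , q)
  ... | inj₂ q = map₂ (λ { (i , r) → suc i , r }) (≤-foldr⁻ e (tail f) q)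

  ≤-foldr⁺ : ∀ {n} e (f : Vector A n) i → f i ≤ foldr _⊔_ e f
  ≤-foldr⁺ e f zero    = x≤x⊔y _ _
  ≤-foldr⁺ e f (suc i) = trans (≤-foldr⁺ e (tail f) i) (x≤y⊔x _ _)

  foldr-≤ : ∀ {n y} e (f : Vector A n) → e ≤ y → (∀ i → f i ≤ y) → foldr _⊔_ e f ≤ y
  foldr-≤ {zero}  e f p q = p
  foldr-≤ {suc n} e f p q = ⊔-lub (q zero) (foldr-≤ e (tail f) p (q ∘ suc))

-- Serves both directions of the equivalence: a finite conjunction stays finite when each conjunct
-- is split into finitely many others. `G` is the side condition known of the old conjuncts and `K`
-- the one owed for the new, such as being a hemispace.
refine-All : ∀ {a b g k} {A : Set a} {B : Set b} {X : Set} {G : A → Set g} {K : B → Set k}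
  {P : X → A → Set} {Q : X → B → Set} →
  (∀ u → G u → ∃[ vs ] (All K vs × (∀ x → P x u ⇔ All (Q x) vs))) →
  ∀ us → All G us → ∃[ vs ] (All K vs × (∀ x → All (P x) us ⇔ All (Q x) vs))
refine-All f []ₗ       []       = []ₗ , [] , λ x → mk⇔ (λ _ → []) (λ _ → [])
refine-All f (u ∷ₗ us) (g ∷ gs) with f u g | refine-All f us gs
... | vs , kvs , p | ws , kws , q = vs ++ ws , All.++⁺ kvs kws , λ x → mk⇔
  (λ { (r ∷ rs) → All.++⁺ (to (p x) r) (to (q x) rs) })
  (λ rs → from (p x) (All.++⁻ˡ vs rs) ∷ from (q x) (All.++⁻ʳ vs rs))

module Hemispace (em : ExcludedMiddle 0ℓ) (R : RealField) where

  open RealField R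
    using ( ℝ; _≤_; _+_; -_; 0#; isDecTotalOrder; +-monoˡ-≤; supremum; +-comm; +-assoc
          ; +-identityˡ; +-identityʳ; +-congʳ; -‿inverseˡ; +-group; +-commutativeSemigroup)
  open Tropical R

  private
    module ℝ = IsDecTotalOrder isDecTotalOrder
    module ℝₘ where
      open TotalOrder ℝmax-totalOrder public
      open Max ℝmax-totalOrder public
      open MaxFold ℝmax-totalOrder public
    module G where
      open TotalOrder 𝔾-totalOrder public
      open Max 𝔾-totalOrder public
      open MaxFold 𝔾-totalOrder public

  open ℝₘ using () renaming (_≤_ to infix 4 _≤ₘ_)
  open GroupProperties +-group using (\\-leftDividesˡ; \\-leftDividesʳ)
  open CommutativeSemigroupProperties +-commutativeSemigroup using (x∙yz≈y∙xz)

  -- The ordered additive group of ℝ.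

  +-monoʳ-≤ : ∀ {x y} z → x ≤ y → z + x ≤ z + y
  +-monoʳ-≤ z p = ℝ.≤-respˡ-≈ (+-comm _ _) (ℝ.≤-respʳ-≈ (+-comm _ _) (+-monoˡ-≤ z p))

  +-cancelˡ-≤ : ∀ {x y} z → z + x ≤ z + y → x ≤ y
  +-cancelˡ-≤ z p =
    ℝ.≤-respˡ-≈ (\\-leftDividesʳ z _) (ℝ.≤-respʳ-≈ (\\-leftDividesʳ z _) (+-monoʳ-≤ (- z) p))

  -x+y≤z⇔y≤z+x : ∀ x y z → (- x + y ≤ z) ⇔ (y ≤ z + x)
  -x+y≤z⇔y≤z+x x y z = mk⇔
    (λ p → ℝ.≤-respˡ-≈ (\\-leftDividesˡ x y) (ℝ.≤-respʳ-≈ (+-comm x z) (+-monoʳ-≤ x p)))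
    (λ p → +-cancelˡ-≤ x
      (ℝ.≤-respˡ-≈ (ℝ.Eq.sym (\\-leftDividesˡ x y)) (ℝ.≤-respʳ-≈ (+-comm z x) p)))

  z≤-x+y⇔z+x≤y : ∀ x y z → (z ≤ - x + y) ⇔ (z + x ≤ y)
  z≤-x+y⇔z+x≤y x y z = mk⇔
    (λ p → ℝ.≤-respʳ-≈ (\\-leftDividesˡ x y) (ℝ.≤-respˡ-≈ (+-comm x z) (+-monoʳ-≤ x p)))
    (λ p → +-cancelˡ-≤ x
      (ℝ.≤-respʳ-≈ (ℝ.Eq.sym (\\-leftDividesˡ x y)) (ℝ.≤-respˡ-≈ (+-comm z x) p)))

  ≰⇒≥ : ∀ {x y} → ¬ x ≤ y → y ≤ x
  ≰⇒≥ {x} {y} p = [ (λ q → contradiction q p) , id ]′ (ℝ.total x y)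

  -- The max-plus semiring.

  -∞≤_ : ∀ x → -∞ ≤ₘ x
  -∞≤_ = InfimumOrder.⊥₋≤_

  pattern fin≤ p = InfimumOrder.[ p ]
  pattern fin≈ p = InfimumEquality.[ p ]

  ⊗-monoʳ : ∀ x {y z} → y ≤ₘ z → x ⊗ y ≤ₘ x ⊗ z
  ⊗-monoʳ -∞      p                       = -∞≤ _
  ⊗-monoʳ (fin x) (InfimumOrder.⊥₋≤ _)    = -∞≤ _
  ⊗-monoʳ (fin x) (fin≤ p)                = fin≤ (+-monoʳ-≤ x p)

  ⊗-congˡ : ∀ x {y z} → y ≈₋ z → x ⊗ y ≈₋ x ⊗ z
  ⊗-congˡ x p = ℝₘ.antisym (⊗-monoʳ x (ℝₘ.reflexive p)) (⊗-monoʳ x (ℝₘ.reflexive (ℝₘ.Eq.sym p)))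

  ⊗-congʳ : ∀ {x y} z → x ≈₋ y → x ⊗ z ≈₋ y ⊗ z
  ⊗-congʳ z       InfimumEquality.⊥₋≈⊥₋ = ℝₘ.Eq.refl
  ⊗-congʳ -∞      (fin≈ p)               = ℝₘ.Eq.refl
  ⊗-congʳ (fin z) (fin≈ p)               = fin≈ (+-congʳ p)

  ⊗-zeroʳ : ∀ x → x ⊗ -∞ ≡ -∞
  ⊗-zeroʳ -∞      = ≡.refl
  ⊗-zeroʳ (fin x) = ≡.refl

  ⊗-identityˡ : ∀ x → fin 0# ⊗ x ≈₋ x
  ⊗-identityˡ -∞      = ℝₘ.Eq.refl
  ⊗-identityˡ (fin x) = fin≈ (+-identityˡ x)

  ⊗-identityʳ : ∀ x → x ⊗ fin 0# ≈₋ x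
  ⊗-identityʳ -∞      = ℝₘ.Eq.refl
  ⊗-identityʳ (fin x) = fin≈ (+-identityʳ x)

  ⊗-assoc : ∀ x y z → (x ⊗ y) ⊗ z ≈₋ x ⊗ (y ⊗ z)
  ⊗-assoc -∞      y       z       = ℝₘ.Eq.refl
  ⊗-assoc (fin x) -∞      z       = ℝₘ.Eq.refl
  ⊗-assoc (fin x) (fin y) -∞      = ℝₘ.Eq.refl
  ⊗-assoc (fin x) (fin y) (fin z) = fin≈ (+-assoc x y z)

  ⊗-swap : ∀ x y z → x ⊗ (y ⊗ z) ≈₋ y ⊗ (x ⊗ z)
  ⊗-swap -∞      y       z       = ℝₘ.Eq.reflexive (≡.sym (⊗-zeroʳ y))
  ⊗-swap (fin x) -∞      z       = ℝₘ.Eq.refl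
  ⊗-swap (fin x) (fin y) -∞      = ℝₘ.Eq.refl
  ⊗-swap (fin x) (fin y) (fin z) = fin≈ (x∙yz≈y∙xz x y z)

  ⊗-inverse : ∀ s x → fin (- s) ⊗ (fin s ⊗ x) ≈₋ x
  ⊗-inverse s -∞      = ℝₘ.Eq.refl
  ⊗-inverse s (fin x) = fin≈ (\\-leftDividesʳ s x)

  ⊗-distribˡ-⊕ : ∀ x y z → x ⊗ (y ⊕ z) ≈₋ (x ⊗ y) ⊕ (x ⊗ z)
  ⊗-distribˡ-⊕ x = ℝₘ.mono-≤-distrib-⊔ (⊗-congˡ x) (⊗-monoʳ x)

  ⊕-identityˡ : ∀ x → -∞ ⊕ x ≈₋ x
  ⊕-identityˡ = ℝₘ.⊔-identityˡ -∞≤_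

  ⊕-identityʳ : ∀ x → x ⊕ -∞ ≈₋ x
  ⊕-identityʳ = ℝₘ.⊔-identityʳ -∞≤_

  -- Comparison through a coefficient in 𝔾.

  infix 4 _≤[_]_

  -- The relation `ι x ≤𝔾 b ⊗𝔾 ι y` unfolded by cases, so that it computes to a statement about ℝ. A
  -- coefficient `β ⁻` gives the strict inequality x < β + y, stated as a negation.
  _≤[_]_ : ℝmax → 𝔾 → ℝmax → Set
  -∞    ≤[ b         ] y     = ⊤
  fin x ≤[ b         ] -∞    = ⊥
  fin x ≤[ ext ⊥±    ] fin y = ⊥
  fin x ≤[ ext [ β ] ] fin y = x ≤ β + y
  fin x ≤[ ext ⊤±    ] fin y = ⊤
  fin x ≤[ β ⁻       ] fin y = ¬ β + y ≤ x

  ⊥±-minimum : ∀ g → ext ⊥± ≤𝔾 g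
  ⊥±-minimum (ext x) = ext≤ext (ExtremaOrder.≤±-minimum _≤_ x)
  ⊥±-minimum (β ⁻)   = ext<neg (ExtremaOrder.⊥±≤[ β ] , λ { (SupremumEquality.[ () ]) })

  ≤[]⇒≤𝔾 : ∀ x b y → x ≤[ b ] y → ι x ≤𝔾 b ⊗𝔾 ι y
  ≤[]⇒≤𝔾 -∞      b           y       p = ⊥±-minimum _
  ≤[]⇒≤𝔾 (fin x) (ext [ β ]) (fin y) p = ext≤ext ExtremaOrder.[ p ]
  ≤[]⇒≤𝔾 (fin x) (ext ⊤±)    (fin y) p = ext≤ext ExtremaOrder.[ x ]≤⊤±
  ≤[]⇒≤𝔾 (fin x) (β ⁻)       (fin y) p =
    ext<neg (ExtremaOrder.[ ≰⇒≥ p ] ,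
      λ { ExtremaEquality.[ q ] → p (ℝ.reflexive (ℝ.Eq.sym q)) })

  ⊗𝔾-zeroʳ : ∀ b → b ⊗𝔾 ι -∞ ≡ ext ⊥±
  ⊗𝔾-zeroʳ (ext ⊥±)    = ≡.refl
  ⊗𝔾-zeroʳ (ext [ β ]) = ≡.refl
  ⊗𝔾-zeroʳ (ext ⊤±)    = ≡.refl
  ⊗𝔾-zeroʳ (β ⁻)       = ≡.refl

  -- Turns a constant term into the coefficient of a coordinate held at 0.
  ⊗𝔾-identityʳ : ∀ b → b ⊗𝔾 ι (fin 0#) ≈𝔾 b
  ⊗𝔾-identityʳ (ext ⊥±)    = G.Eq.refl
  ⊗𝔾-identityʳ (ext [ β ]) = ext ExtremaEquality.[ +-identityʳ β ]
  ⊗𝔾-identityʳ (ext ⊤±)    = G.Eq.refl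
  ⊗𝔾-identityʳ (β ⁻)       = neg (+-identityʳ β)

  ι-⊗ : ∀ x y → ι x ⊗𝔾 ι y ≡ ι (x ⊗ y)
  ι-⊗ -∞      y       = ≡.refl
  ι-⊗ (fin x) -∞      = ≡.refl
  ι-⊗ (fin x) (fin y) = ≡.refl

  ≤𝔾⇒≤[] : ∀ x b y → ι x ≤𝔾 b ⊗𝔾 ι y → x ≤[ b ] y
  ≤𝔾⇒≤[] -∞      b           y       p = tt
  ≤𝔾⇒≤[] (fin x) b           -∞      p with b ⊗𝔾 ι -∞ | ⊗𝔾-zeroʳ b | p
  ... | _ | ≡.refl | ext≤ext (SupremumOrder.[ () ])
  ≤𝔾⇒≤[] (fin x) (ext ⊥±)    (fin y) (ext≤ext (SupremumOrder.[ () ]))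
  ≤𝔾⇒≤[] (fin x) (ext [ β ]) (fin y) (ext≤ext ExtremaOrder.[ p ]) = p
  ≤𝔾⇒≤[] (fin x) (ext ⊤±)    (fin y) p = tt
  ≤𝔾⇒≤[] (fin x) (β ⁻)       (fin y) (ext<neg (ExtremaOrder.[ p ] , x≉)) q =
    x≉ ExtremaEquality.[ ℝ.antisym p q ]

  -- Going through `≤𝔾` reduces this to transitivity and to monotonicity of multiplication by b.
  ≤[]-mono : ∀ {x x′ y y′} b → x′ ≤ₘ x → y ≤ₘ y′ → x ≤[ b ] y → x′ ≤[ b ] y′
  ≤[]-mono {x} {x′} {y} {y′} b p q r = ≤𝔾⇒≤[] x′ b y′
    (G.trans (ι-mono p) (G.trans (≤[]⇒≤𝔾 x b y r) (⊗𝔾-mono b q)))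
    where
    ι-mono : ∀ {x y} → x ≤ₘ y → ι x ≤𝔾 ι y
    ι-mono p = ext≤ext SupremumOrder.[ p ]

    ⊗𝔾-mono : ∀ b {x y} → x ≤ₘ y → b ⊗𝔾 ι x ≤𝔾 b ⊗𝔾 ι y
    ⊗𝔾-mono b (InfimumOrder.⊥₋≤ y) rewrite ⊗𝔾-zeroʳ b = ⊥±-minimum _
    ⊗𝔾-mono (ext ⊥±)    (fin≤ p) = G.refl
    ⊗𝔾-mono (ext [ β ]) (fin≤ p) = ext≤ext ExtremaOrder.[ +-monoʳ-≤ β p ]
    ⊗𝔾-mono (ext ⊤±)    (fin≤ p) = G.refl
    ⊗𝔾-mono (β ⁻)       (fin≤ p) = neg≤ ExtremaOrder.[ +-monoʳ-≤ β p ]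

  ≤[]-scale : ∀ s {x b y} → x ≤[ b ] y → fin s ⊗ x ≤[ b ] fin s ⊗ y
  ≤[]-scale s { -∞}                        p = tt
  ≤[]-scale s {fin x} {ext [ β ]} {fin y} p = ℝ.≤-respʳ-≈ (x∙yz≈y∙xz s β y) (+-monoʳ-≤ s p)
  ≤[]-scale s {fin x} {ext ⊤±}    {fin y} p = tt
  ≤[]-scale s {fin x} {β ⁻}       {fin y} p q =
    p (+-cancelˡ-≤ s (ℝ.≤-respˡ-≈ (x∙yz≈y∙xz β s y) q))

  -- Points as a max-plus module, and conical hemispaces.

  infixl 6 _⊞_
  infixl 7 _⊙_
  infix  4 _≤ᵖ_

  _⊞_ : ∀ {n} → Point n → Point n → Point n
  (x ⊞ y) i = x i ⊕ y i

  _⊙_ : ∀ {n} → ℝmax → Point n → Point n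
  (s ⊙ x) i = s ⊗ x i

  _≤ᵖ_ : ∀ {n} → Point n → Point n → Set
  x ≤ᵖ y = ∀ i → x i ≤ₘ y i

  ⊞-cong : ∀ {n} {x x′ y y′ : Point n} → x ≋ x′ → y ≋ y′ → (x ⊞ y) ≋ (x′ ⊞ y′)
  ⊞-cong p q i = ℝₘ.⊔-cong (p i) (q i)

  ≋-sym : ∀ {n} {x y : Point n} → x ≋ y → y ≋ x
  ≋-sym p i = ℝₘ.Eq.sym (p i)

  ≋-trans : ∀ {n} {x y z : Point n} → x ≋ y → y ≋ z → x ≋ z
  ≋-trans p q i = ℝₘ.Eq.trans (p i) (q i)

  ⨁ : ∀ {m n} → Vector (Point n) m → Point n
  ⨁ = foldr _⊞_ (replicate _ -∞)

  ⨁-upper : ∀ {m n} (g : Vector (Point n) m) i → g i ≤ᵖ ⨁ g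
  ⨁-upper g zero    k = ℝₘ.x≤x⊔y (g zero k) (⨁ (tail g) k)
  ⨁-upper g (suc i) k = ℝₘ.trans (⨁-upper (tail g) i k) (ℝₘ.x≤y⊔x (g zero k) _)

  ⨁-least : ∀ {m n} (g : Vector (Point n) m) {x} → (∀ i → g i ≤ᵖ x) → ⨁ g ≤ᵖ x
  ⨁-least {zero}  g p k = -∞≤ _
  ⨁-least {suc m} g p k = ℝₘ.⊔-lub (p zero k) (⨁-least (tail g) (p ∘ suc) k)

  Closed-⊞ : ∀ {n} → Pred (Point n) 0ℓ → Set
  Closed-⊞ A = ∀ {x y} → x ∈ A → y ∈ A → x ⊞ y ∈ A

  Closed-⊙ : ∀ {n} → Pred (Point n) 0ℓ → Set
  Closed-⊙ A = ∀ s {x} → x ∈ A → fin s ⊙ x ∈ A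

  -- Membership of the zero vector −∞ is left unspecified.
  record IsConicalHemispace {n} (A : Pred (Point n) 0ℓ) : Set where
    field
      respects    : A Respects _≋_
      ⊙-closed    : Closed-⊙ A
      ⊞-closed    : Closed-⊞ A
      ∁-⊞-closed  : Closed-⊞ (∁ A)

    ∁-resp : ∁ A Respects _≋_
    ∁-resp p x∉A y∈A = x∉A (respects (≋-sym p) y∈A)

    -- Finite scalings are invertible: scaling back by `- s` would return the point to A.
    ∁-⊙-closed : Closed-⊙ (∁ A)
    ∁-⊙-closed s x∉A sx∈A = x∉A (respects (λ i → ⊗-inverse s _) (⊙-closed (- s) sx∈A))

  open IsConicalHemispace

  dne : ∀ {P : Set} → ¬ ¬ P → P
  dne = decidable-stable em

  ∁-isConicalHemispace : ∀ {n} {A : Pred (Point n) 0ℓ} →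
                         IsConicalHemispace A → IsConicalHemispace (∁ A)
  ∁-isConicalHemispace A = record
    { respects   = ∁-resp A
    ; ⊙-closed   = ∁-⊙-closed A
    ; ⊞-closed   = ∁-⊞-closed A
    ; ∁-⊞-closed = λ p q r → r (⊞-closed A (dne p) (dne q))
    }

  module _ {n} {A : Pred (Point n) 0ℓ} (A-resp : A Respects _≋_) (A-⊞ : Closed-⊞ A) where

    -- At least one summand is demanded because the empty sum is the zero vector, which may lie on
    -- either side.
    ⨁-closed : ∀ {m} (g : Vector (Point n) (suc m)) → (∀ i → g i ∈ A) → ⨁ g ∈ A
    ⨁-closed {zero}  g p = A-resp (λ k → ℝₘ.Eq.sym (⊕-identityʳ _)) (p zero)
    ⨁-closed {suc m} g p = A-⊞ (p zero) (⨁-closed (tail g) (p ∘ suc))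

    -- Vectors below x that together attain each of its coordinates have x as their sum.
    covered⇒∈ : ∀ {m x} (g : Vector (Point n) (suc m)) → (∀ i → g i ∈ A) →
                (∀ i → g i ≤ᵖ x) → (∀ k → ∃[ i ] x k ≤ₘ g i k) → x ∈ A
    covered⇒∈ g g∈A g≤x cover = A-resp
      (λ k → ℝₘ.antisym (⨁-least g g≤x k)
                        (ℝₘ.trans (proj₂ (cover k)) (⨁-upper g (proj₁ (cover k)) k)))
      (⨁-closed g g∈A)

  -- Vectors with at most two finite coordinates; down-sets of ℝ.

  single : ∀ {n} → Fin n → ℝmax → Point n
  single i s = updateAt (replicate _ -∞) i (const s)

  module _ {n} (P : Fin n → ℝmax → Set) (i : Fin n) {s : ℝmax} where

    single-elim : P i s → (∀ k → P k -∞) → ∀ k → P k (single i s k)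
    single-elim p q k with k ≟ i
    ... | yes ≡.refl = ≡.subst (P i) (≡.sym (updateAt-updates i (replicate _ -∞))) p
    ... | no  k≢i    = ≡.subst (P k) (≡.sym (updateAt-minimal k i (replicate _ -∞) k≢i)) (q k)

  single-≤ : ∀ {n} (i : Fin n) x → single i (x i) ≤ᵖ x
  single-≤ i x = single-elim (λ k t → t ≤ₘ x k) i ℝₘ.refl (λ k → -∞≤ _)

  ≤-single : ∀ {n} (i : Fin n) s → s ≤ₘ single i s i
  ≤-single i s = ℝₘ.reflexive (ℝₘ.Eq.reflexive (≡.sym (updateAt-updates i (replicate _ -∞))))

  -- For i = j both entries fall on one coordinate, which carries their maximum.
  pair : ∀ {n} → Fin n → Fin n → ℝmax → ℝmax → Point n
  pair i j s t = single i s ⊞ single j t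

  single-mono : ∀ {n} (i : Fin n) {s t} → s ≤ₘ t → single i s ≤ᵖ single i t
  single-mono i {s} {t} p k with k ≟ i
  ... | yes ≡.refl rewrite updateAt-updates i {const s} (replicate _ -∞)
                         | updateAt-updates i {const t} (replicate _ -∞) = p
  ... | no  k≢i    rewrite updateAt-minimal k i {const s} (replicate _ -∞) k≢i = -∞≤ _

  single-cong : ∀ {n} (i : Fin n) {s t} → s ≈₋ t → single i s ≋ single i t
  single-cong i p k = ℝₘ.antisym (single-mono i (ℝₘ.reflexive p) k)
                                 (single-mono i (ℝₘ.reflexive (ℝₘ.Eq.sym p)) k)

  ⊙-single : ∀ {n} (i : Fin n) s t → (s ⊙ single i t) ≋ single i (s ⊗ t)
  ⊙-single i s t k with k ≟ i
  ... | yes ≡.refl rewrite updateAt-updates i {const t} (replicate _ -∞)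
                         | updateAt-updates i {const (s ⊗ t)} (replicate _ -∞) = ℝₘ.Eq.refl
  ... | no  k≢i    rewrite updateAt-minimal k i {const t} (replicate _ -∞) k≢i
                         | updateAt-minimal k i {const (s ⊗ t)} (replicate _ -∞) k≢i =
                           ℝₘ.Eq.reflexive (⊗-zeroʳ s)

  single--∞ : ∀ {n} (i : Fin n) k → single i -∞ k ≡ -∞
  single--∞ i = single-elim (λ _ s → s ≡ -∞) i ≡.refl (λ _ → ≡.refl)

  ⊙-pair : ∀ {n} (i j : Fin n) r s t → (r ⊙ pair i j s t) ≋ pair i j (r ⊗ s) (r ⊗ t)
  ⊙-pair i j r s t k =
    ℝₘ.Eq.trans (⊗-distribˡ-⊕ r _ _) (⊞-cong (⊙-single i r s) (⊙-single j r t) k)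

  pair-≤ : ∀ {n} (z : Point n) i j → pair i j (z i) (z j) ≤ᵖ z
  pair-≤ z i j k = ℝₘ.⊔-lub (single-≤ i z k) (single-≤ j z k)

  ≤-pairˡ : ∀ {n} (z : Point n) i j → z i ≤ₘ pair i j (z i) (z j) i
  ≤-pairˡ z i j =
    ℝₘ.trans (≤-single i (z i)) (ℝₘ.x≤x⊔y (single i (z i) i) (single j (z j) i))

  ≤-pairʳ : ∀ {n} (z : Point n) i j → z j ≤ₘ pair i j (z i) (z j) j
  ≤-pairʳ z i j =
    ℝₘ.trans (≤-single j (z j)) (ℝₘ.x≤y⊔x (single i (z i) j) (single j (z j) j))

  pair-cong : ∀ {n} (i j : Fin n) {s s′ t t′} → s ≈₋ s′ → t ≈₋ t′ →
              pair i j s t ≋ pair i j s′ t′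
  pair-cong i j p q = ⊞-cong (single-cong i p) (single-cong j q)

  -- A down-set of ℝ is empty, all of ℝ, or a closed or open half-line: these are the
  -- four kinds of coefficients in 𝔾.
  downSet-cut : (D : Pred ℝ 0ℓ) → (∀ {u t} → u ≤ t → t ∈ D → u ∈ D) →
                ∃[ b ] (∀ s t → (- s + t ∈ D) ⇔ (fin t ≤[ b ] fin s))
  downSet-cut D down with em {P = ∃ D}
  ... | no  empty = ext ⊥± , λ s t → mk⇔ (λ p → empty (_ , p)) (λ ())
  ... | yes inhabited with em {P = ∃ (RealField.UpperBound R D)}
  ...   | no  unbounded = ext ⊤± , λ s t → mk⇔ (const tt) λ _ → dne λ u∉D →
            unbounded (_ , λ v v∈D → ≰⇒≥ λ u≤v → u∉D (down u≤v v∈D))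
  ...   | yes bounded with supremum D inhabited bounded
  ...     | τ , upper , least with em {P = τ ∈ D}
  ...       | yes τ∈D = ext [ τ ] , λ s t → mk⇔
                (λ p → to (-x+y≤z⇔y≤z+x s t τ) (upper _ p))
                (λ p → down (from (-x+y≤z⇔y≤z+x s t τ) p) τ∈D)
  ...       | no  τ∉D = τ ⁻ , λ s t → mk⇔
                (λ p q → τ∉D (down (from (z≤-x+y⇔z+x≤y s t τ) q) p))
                (λ p → dne λ u∉D → p (to (z≤-x+y⇔z+x≤y s t τ)
                  (least _ λ v v∈D → ≰⇒≥ λ u≤v → u∉D (down u≤v v∈D))))

  -- Membership in a conical hemispace by pairs of coordinates.

  module _ {n} {A : Pred (Point (suc n)) 0ℓ} (A-con : IsConicalHemispace A) where

    -- Quantifying over the finite value t makes the condition vacuous when z j is -∞.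
    Paired : Fin (suc n) → Point (suc n) → Set
    Paired j z = ∀ t → z j ≡ fin t → ∃[ i ] pair i j (z i) (fin t) ∈ A

    -- If all pairs at some j are outside A, then so is z, which is their sum.
    ∈⇒paired : ∀ {z} → z ∈ A → ∀ j → Paired j z
    ∈⇒paired {z} z∈A j t zj≡t with em {P = ∃[ i ] pair i j (z i) (fin t) ∈ A}
    ... | yes p = p
    ... | no  p = contradiction z∈A (covered⇒∈ (∁-resp A-con) (∁-⊞-closed A-con)
      (λ i → pair i j (z i) (z j))
      (λ i q → p (i , ≡.subst (λ s → pair i j (z i) s ∈ A) zj≡t q))
      (λ i → pair-≤ z i j)
      (λ k → k , ≤-pairˡ z k j))

    -- The chosen pairs lie in A and below z, and the one for j attains coordinate j, so they sum to
    -- z.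
    paired⇒∈ : ∀ {z t₀} → z zero ≡ fin t₀ → (∀ j → Paired j z) → z ∈ A
    paired⇒∈ {z} {t₀} z₀≡t₀ paired = covered⇒∈ (respects A-con) (⊞-closed A-con)
      (λ j → proj₁ (summand j)) (λ j → proj₁ (proj₂ (summand j)))
      (λ j → proj₁ (proj₂ (proj₂ (summand j))))
      (λ k → k , proj₂ (proj₂ (proj₂ (summand k))))
      where
      member : ∀ j t → z j ≡ fin t → ∃[ g ] (g ∈ A × g ≤ᵖ z × z j ≤ₘ g j)
      member j t zj≡t with paired j t zj≡t
      ... | i , p = pair i j (z i) (z j) ,
        ≡.subst (λ s → pair i j (z i) s ∈ A) (≡.sym zj≡t) p , pair-≤ z i j , ≤-pairʳ z i j

      summand : ∀ j → ∃[ g ] (g ∈ A × g ≤ᵖ z × z j ≤ₘ g j)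
      summand j with z j in eq
      ... | fin t = ≡.subst (λ s → ∃[ g ] (g ∈ A × g ≤ᵖ z × s ≤ₘ g j)) eq (member j t eq)
      -- A coordinate -∞ is attained by any vector, so any element of A below z will do; finiteness
      -- of `z zero` provides one.
      ... | -∞ with member zero t₀ z₀≡t₀
      ...   | g , g∈A , g≤z , _ = g , g∈A , g≤z , -∞≤ _

    scaled-unit : ∀ j s → single j (fin 0#) ∈ A → single j (fin s) ∈ A
    scaled-unit j s p = respects A-con
      (≋-trans (⊙-single j (fin s) (fin 0#)) (single-cong j (⊗-identityʳ (fin s))))
      (⊙-closed A-con s p)

    -- For finite s, scaling by -s brings the first entry to 0, so membership depends on t - s
    -- alone. The admissible differences form a down-set, and `downSet-cut` reads off its
    -- coefficient.
    pair-coefficient : ∀ i j → single j (fin 0#) ∉ A →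
      ∃[ b ] (∀ s t → (pair i j s (fin t) ∈ A) ⇔ (fin t ≤[ b ] s))
    pair-coefficient i j eⱼ∉A = proj₁ cut , equivalence
      where
      D : Pred ℝ 0ℓ
      D t = pair i j (fin 0#) (fin t) ∈ A

      single-∉ : ∀ t → single j (fin t) ∉ A
      single-∉ t p = eⱼ∉A (respects A-con
        (≋-trans (⊙-single j _ _) (single-cong j (fin≈ (-‿inverseˡ t)))) (⊙-closed A-con (- t) p))

      -- A sum of two vectors outside A is outside A; the j-part of the pair is outside, so the
      -- i-part must be inside.
      eᵢ∈A : ∀ {t} → t ∈ D → single i (fin 0#) ∈ A
      eᵢ∈A t∈D = dne λ eᵢ∉A → ∁-⊞-closed A-con eᵢ∉A (single-∉ _) t∈D

      -- Scaling the pair by u - t ≤ 0 lowers the second entry to u, and adding the i-th unit vector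
      -- restores the first entry to 0.
      down : ∀ {u t} → u ≤ t → t ∈ D → u ∈ D
      down {u} {t} u≤t t∈D = respects A-con shift
        (⊞-closed A-con (eᵢ∈A t∈D) (⊙-closed A-con (- t + u) t∈D))
        where
        r≤0 : - t + u ≤ 0#
        r≤0 = from (-x+y≤z⇔y≤z+x t u 0#) (ℝ.≤-respʳ-≈ (ℝ.Eq.sym (+-identityˡ t)) u≤t)

        shift : (single i (fin 0#) ⊞ fin (- t + u) ⊙ pair i j (fin 0#) (fin t)) ≋
                pair i j (fin 0#) (fin u)
        shift k = ℝₘ.Eq.trans
          (ℝₘ.⊔-congˡ (single i (fin 0#) k) (≋-trans (⊙-pair i j (fin (- t + u)) (fin 0#) (fin t))
            (pair-cong i j (⊗-identityʳ _)
              (fin≈ (ℝ.Eq.trans (+-comm _ t) (\\-leftDividesˡ t u)))) k))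
          (ℝₘ.Eq.trans
            (ℝₘ.Eq.sym (ℝₘ.⊔-assoc (single i (fin 0#) k) (single i (fin (- t + u)) k)
                                   (single j (fin u) k)))
            (ℝₘ.⊔-congʳ (single j (fin u) k) (ℝₘ.x≤y⇒y⊔x≈y (single-mono i (fin≤ r≤0) k))))

      cut = downSet-cut D down

      normalise : ∀ s t → (fin (- s) ⊙ pair i j (fin s) (fin t)) ≋ pair i j (fin 0#) (fin (- s + t))
      normalise s t = ≋-trans (⊙-pair i j _ _ _) (pair-cong i j (fin≈ (-‿inverseˡ s)) ℝₘ.Eq.refl)

      equivalence : ∀ s t → (pair i j s (fin t) ∈ A) ⇔ (fin t ≤[ proj₁ cut ] s)
      -- With s = -∞ the pair is `single j (fin t)`, which is outside A, and the right side is empty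
      -- by definition.
      equivalence -∞ t = mk⇔
        (λ p → single-∉ t (respects A-con (λ k → ℝₘ.Eq.trans
                 (ℝₘ.⊔-congʳ (single j (fin t) k) (ℝₘ.Eq.reflexive (single--∞ i k)))
                 (⊕-identityˡ (single j (fin t) k))) p))
        (λ ())
      equivalence (fin s) t = proj₂ cut s t ⇔-∘ mk⇔
        (λ p → respects A-con (normalise s t) (⊙-closed A-con (- s) p))
        (λ p → dne λ q → ∁-⊙-closed A-con (- s) q (respects A-con (≋-sym (normalise s t)) p))

    paired-coefficients : ∀ j → ∃[ b ] (∀ z → Paired j z ⇔ (∃[ i ] z j ≤[ b i ] z i))
    paired-coefficients j with em {P = single j (fin 0#) ∈ A}
    -- Here j imposes no constraint: the pair (j, j) always lies in A. The coefficient 0 makes the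
    -- inequality hold through zⱼ ≤ 0 + zⱼ.
    ... | yes eⱼ∈A = (λ _ → ext [ 0# ]) , λ z → mk⇔
      (λ _ → j , reflexive (z j))
      (λ _ t zj≡t → j , ≡.subst (λ s → pair j j s (fin t) ∈ A) (≡.sym zj≡t)
        (⊞-closed A-con (scaled-unit j t eⱼ∈A) (scaled-unit j t eⱼ∈A)))
      where
      reflexive : ∀ x → x ≤[ ext [ 0# ] ] x
      reflexive -∞      = tt
      reflexive (fin x) = ℝ.reflexive (ℝ.Eq.sym (+-identityˡ x))
    ... | no eⱼ∉A = b , equivalence
      where
      b : Fin (suc n) → 𝔾
      b i = proj₁ (pair-coefficient i j eⱼ∉A)

      equivalence : ∀ z → Paired j z ⇔ (∃[ i ] z j ≤[ b i ] z i)
      equivalence z with z j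
      ... | -∞    = mk⇔ (λ _ → j , tt) (λ _ _ ())
      ... | fin t = mk⇔
        (λ p → proj₁ (p t ≡.refl) ,
          to (proj₂ (pair-coefficient (proj₁ (p t ≡.refl)) j eⱼ∉A) (z (proj₁ (p t ≡.refl))) t)
             (proj₂ (p t ≡.refl)))
        (λ { (i , q) _ ≡.refl → i , from (proj₂ (pair-coefficient i j eⱼ∉A) (z i) t) q })

    ∈⇔inequalities : ∃[ b ] (∀ {z t} → z zero ≡ fin t →
                     (z ∈ A) ⇔ (∀ j → ∃[ i ] z j ≤[ b j i ] z i))
    ∈⇔inequalities = (λ j → proj₁ (paired-coefficients j)) , λ {z} z₀≡t → mk⇔
      (λ z∈A j → to (proj₂ (paired-coefficients j) z) (∈⇒paired z∈A j))
      (λ p → paired⇒∈ z₀≡t λ j → from (proj₂ (paired-coefficients j) z) (p j))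

  -- Slices at height zero, and homogenisation.

  homogeneous : ∀ {n} → Point n → Point (suc n)
  homogeneous x = fin 0# ∷ᵥ x

  combination : ∀ {n} → ℝmax → ℝmax → Point n → Point n → Point n
  combination s t x y = s ⊙ x ⊞ t ⊙ y

  Slice : ∀ {n} → Pred (Point (suc n)) 0ℓ → Pred (Point n) 0ℓ
  Slice A x = homogeneous x ∈ A

  Slice-resp : ∀ {n} {A : Pred (Point (suc n)) 0ℓ} → A Respects _≋_ → Slice A Respects _≋_
  Slice-resp resp p = resp λ { zero → ℝₘ.Eq.refl ; (suc k) → p k }

  -- The combination of two points at height 0 has height s ⊕ t = 0, so it is again a homogenised
  -- point.
  Slice-convex : ∀ {n} {A : Pred (Point (suc n)) 0ℓ} → A Respects _≋_ →
                 Closed-⊙ A → Closed-⊞ A → Convex (Slice A)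
  Slice-convex {A = A} resp ⊙-cl ⊞-cl x y x∈A y∈A s t s⊕t≈0 =
    resp homogeneous-combination (member s t s⊕t≈0)
    where
    x̂ = homogeneous x
    ŷ = homogeneous y

    homogeneous-combination : combination s t x̂ ŷ ≋ homogeneous (combination s t x y)
    homogeneous-combination zero =
      ℝₘ.Eq.trans (ℝₘ.⊔-cong (⊗-identityʳ s) (⊗-identityʳ t)) s⊕t≈0
    homogeneous-combination (suc k) = ℝₘ.Eq.refl

    -- The weight -∞ is not a scaling covered by `Closed-⊙`, so such a term is dropped; the
    -- constraint on s ⊕ t forbids both weights from being -∞.
    member : ∀ s t → s ⊕ t ≈₋ fin 0# → combination s t x̂ ŷ ∈ A
    member -∞      (fin t) _ = resp (λ k → ℝₘ.Eq.sym (⊕-identityˡ _)) (⊙-cl t y∈A)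
    member (fin s) -∞      _ = resp (λ k → ℝₘ.Eq.sym (⊕-identityʳ _)) (⊙-cl s x∈A)
    member (fin s) (fin t) _ = ⊞-cl (⊙-cl s x∈A) (⊙-cl t y∈A)
    member -∞      -∞      ()

  slice : ∀ {n} {A : Pred (Point (suc n)) 0ℓ} → IsConicalHemispace A → Subset n
  slice {A = A} A-con = record { pred = Slice A ; resp = Slice-resp (respects A-con) }

  slice-isHemispace : ∀ {n} {A : Pred (Point (suc n)) 0ℓ} (A-con : IsConicalHemispace A) →
                      IsHemispace (slice A-con)
  slice-isHemispace A-con =
    Slice-convex (respects A-con) (⊙-closed A-con) (⊞-closed A-con) ,
    Slice-convex (∁-resp A-con) (∁-⊙-closed A-con) (∁-⊞-closed A-con)

  module _ {n} {H : Pred (Point n) 0ℓ} (H-resp : H Respects _≋_)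
           (H-convex : Convex H) (∁H-convex : Convex (∁ H)) (origin : replicate n -∞ ∈ H) where

    -- As the origin lies in H, for finite z zero it suffices to test t = − z zero; a point
    -- at infinity belongs to the cone when its whole ray lies in H.
    Homogenised : Pred (Point (suc n)) 0ℓ
    Homogenised z = ∀ t → fin t ⊗ z zero ≤ₘ fin 0# → fin t ⊙ tail z ∈ H

    private
      H-⊞ : ∀ {x y} → x ∈ H → y ∈ H → x ⊞ y ∈ H
      H-⊞ {x} {y} p q = H-resp
        (λ k → ℝₘ.⊔-cong (⊗-identityˡ (x k)) (⊗-identityˡ (y k)))
        (H-convex x y p q (fin 0#) (fin 0#) (ℝₘ.⊔-idem _))

      -- The weight t - s ≤ 0 turns s ⊙ x into t ⊙ x; with weight 0 on t ⊙ y this is a convex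
      -- combination of points outside H.
      ∁H-combine : ∀ {s t} {x y : Point n} → t ≤ s →
                   fin s ⊙ x ∉ H → fin t ⊙ y ∉ H → fin t ⊙ (x ⊞ y) ∉ H
      ∁H-combine {s} {t} {x} {y} t≤s p q r =
        ∁H-convex (fin s ⊙ x) (fin t ⊙ y) p q (fin (- s + t)) (fin 0#)
          (ℝₘ.x≤y⇒x⊔y≈y (fin≤ (from (-x+y≤z⇔y≤z+x s t 0#)
            (ℝ.≤-respʳ-≈ (ℝ.Eq.sym (+-identityˡ s)) t≤s))))
          (H-resp (λ k → ℝₘ.Eq.trans (⊗-distribˡ-⊕ (fin t) (x k) (y k))
            (ℝₘ.⊔-cong (ℝₘ.Eq.sym (rescale (x k))) (ℝₘ.Eq.sym (⊗-identityˡ (fin t ⊗ y k))))) r)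
        where
        rescale : ∀ a → fin (- s + t) ⊗ (fin s ⊗ a) ≈₋ fin t ⊗ a
        rescale a = ℝₘ.Eq.trans (ℝₘ.Eq.sym (⊗-assoc (fin (- s + t)) (fin s) a))
          (⊗-congʳ a (fin≈ (ℝ.Eq.trans (+-comm _ s) (\\-leftDividesˡ s t))))

    -- A test passed by a sum's height is passed by both summands' heights, which gives closure
    -- under `⊞`. If x fails at s and y fails at t, then x ⊞ y fails at the smaller of s and t: both
    -- heights still pass there, and `∁H-combine` applies.
    homogenised-isConicalHemispace : IsConicalHemispace Homogenised
    homogenised-isConicalHemispace = record
      { respects   = λ {x} {y} x≋y p t q → H-resp (λ k → ⊗-congˡ (fin t) (x≋y (suc k)))
                       (p t (ℝₘ.≤-respˡ-≈ (⊗-congˡ (fin t) (ℝₘ.Eq.sym (x≋y zero))) q))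
      ; ⊙-closed   = λ s {x} p t q → H-resp (λ k → ⊗-assoc (fin t) (fin s) (x (suc k)))
                       (p (t + s) (ℝₘ.≤-respˡ-≈ (ℝₘ.Eq.sym (⊗-assoc (fin t) (fin s) (x zero))) q))
      ; ⊞-closed   = λ {x} {y} p q t r →
          H-resp (λ k → ℝₘ.Eq.sym (⊗-distribˡ-⊕ (fin t) (x (suc k)) (y (suc k))))
            (H-⊞ (p t (ℝₘ.trans (⊗-monoʳ (fin t) (ℝₘ.x≤x⊔y (x zero) (y zero))) r))
                 (q t (ℝₘ.trans (⊗-monoʳ (fin t) (ℝₘ.x≤y⊔x (x zero) (y zero))) r)))
      ; ∁-⊞-closed = λ {x} {y} p q r → p λ s s≤ → dne λ p′ → q λ t t≤ → dne λ q′ →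
                       separate {s} {t} {x} {y} s≤ p′ t≤ q′ r
      }
      where
      height : ∀ {t s z} → t ≤ s → fin s ⊗ z ≤ₘ fin 0# → fin t ⊗ z ≤ₘ fin 0#
      height {z = -∞}    p q        = -∞≤ _
      height {z = fin z} p (fin≤ q) = fin≤ (ℝ.trans (+-monoˡ-≤ z p) q)

      separate : ∀ {s t} {x y : Point (suc n)} →
                 fin s ⊗ x zero ≤ₘ fin 0# → fin s ⊙ tail x ∉ H →
                 fin t ⊗ y zero ≤ₘ fin 0# → fin t ⊙ tail y ∉ H → x ⊞ y ∉ Homogenised
      separate {s} {t} {x} {y} s≤ p t≤ q r with ℝ.total t s
      ... | inj₁ t≤s = ∁H-combine t≤s p q (r t (ℝₘ.≤-respˡ-≈
              (ℝₘ.Eq.sym (⊗-distribˡ-⊕ (fin t) (x zero) (y zero))) (ℝₘ.⊔-lub (height t≤s s≤) t≤)))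
      ... | inj₂ s≤t = ∁H-combine s≤t q p (H-resp
              (λ k → ⊗-congˡ (fin s) (ℝₘ.⊔-comm (x (suc k)) (y (suc k)))) (r s (ℝₘ.≤-respˡ-≈
              (ℝₘ.Eq.sym (⊗-distribˡ-⊕ (fin s) (x zero) (y zero))) (ℝₘ.⊔-lub s≤ (height s≤t t≤)))))

    -- At height 0 the tests are those with t ≤ 0, and t ⊙ x is then the convex combination of x and
    -- the origin with weights t and 0. Conversely, t = 0 recovers x.
    slice-homogenised : ∀ x → (x ∈ H) ⇔ (x ∈ Slice Homogenised)
    slice-homogenised x = mk⇔
      (λ x∈H t t≤0 → H-resp (λ k → ⊕-identityʳ (fin t ⊗ x k))
        (H-convex x (replicate n -∞) x∈H origin (fin t) (fin 0#)
          (ℝₘ.x≤y⇒x⊔y≈y (ℝₘ.≤-respˡ-≈ (⊗-identityʳ (fin t)) t≤0))))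
      (λ p → H-resp (λ k → ⊗-identityˡ (x k)) (p 0# (ℝₘ.reflexive (⊗-identityˡ (fin 0#)))))

  -- Either H or its complement contains the origin. That one is homogenised, and in the second case
  -- the complement of the resulting cone is taken.
  hemispace-slice : ∀ {n} (H : Subset n) → IsHemispace H →
    ∃[ A ] (IsConicalHemispace A × (∀ x → (x ∈ pred H) ⇔ (x ∈ Slice A)))
  hemispace-slice {n} H (H-convex , ∁H-convex) with em {P = replicate n -∞ ∈ pred H}
  ... | yes o∈H = _ , homogenised-isConicalHemispace (resp H) H-convex ∁H-convex o∈H ,
                  slice-homogenised (resp H) H-convex ∁H-convex o∈H
  ... | no  o∉H = _ ,
    ∁-isConicalHemispace (homogenised-isConicalHemispace ∁H-resp ∁H-convex ∁∁H-convex o∉H) ,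
    λ x → let e = slice-homogenised ∁H-resp ∁H-convex ∁∁H-convex o∉H x in
      mk⇔ (λ p q → from e q p) (λ p → dne λ q → p (to e q))
    where
    ∁H-resp : ∁ (pred H) Respects _≋_
    ∁H-resp p x∉H y∈H = x∉H (resp H (≋-sym p) y∈H)

    ∁∁H-convex : Convex (∁ (∁ (pred H)))
    ∁∁H-convex x y p q s t e r = r (H-convex x y (dne p) (dne q) s t e)

  -- Mixed inequalities in homogeneous coordinates.

  inequality : ∀ {n} → Vector ℝmax (suc n) → Vector 𝔾 (suc n) → MixedInequality n
  inequality a b = record { a₀ = head a ; a = tail a ; b₀ = head b ; b = tail b }

  Dominated : ∀ {n} → ℝmax → Fin n → Vector 𝔾 n → Pred (Point n) 0ℓ
  Dominated a i b z = ∃[ k ] a ⊗ z i ≤[ b k ] z k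

  module _ {n} (a : Vector ℝmax (suc n)) (b : Vector 𝔾 (suc n)) (x : Point n) where

    private
      x̂ = homogeneous x

      terms : Vector 𝔾 (suc n)
      terms k = b k ⊗𝔾 ι (x̂ k)

      lhs = affine (ι (head a)) (ι ∘ tail a) x
      rhs = affine (head b) (tail b) x

      ≤-rhs⁻ : ∀ {g} → g ≤𝔾 rhs → ∃[ k ] g ≤𝔾 terms k
      ≤-rhs⁻ p with G.x≤y⊔z⇒x≤y⊎x≤z p
      ... | inj₁ q = zero , G.≤-respʳ-≈ (G.Eq.sym (⊗𝔾-identityʳ (head b))) q
      ... | inj₂ q with G.≤-foldr⁻ (ι -∞) (tail terms) q
      -- A value below the -∞ seed of the fold is below every term, so index zero serves.
      ...   | inj₁ r       = zero , G.trans r (⊥±-minimum _)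
      ...   | inj₂ (k , r) = suc k , r

      terms≤rhs : ∀ k → terms k ≤𝔾 rhs
      terms≤rhs zero    = G.≤-respˡ-≈ (G.Eq.sym (⊗𝔾-identityʳ (head b)))
        (G.x≤x⊔y (head b) (foldr _⊕𝔾_ (ι -∞) (tail terms)))
      terms≤rhs (suc k) = G.trans (G.≤-foldr⁺ (ι -∞) (tail terms) k) (G.x≤y⊔x (head b) _)

      lhs-terms : Vector 𝔾 n
      lhs-terms k = ι (a (suc k)) ⊗𝔾 ι (x k)

      lhs-least : ∀ {g} → (∀ i → ι (a i ⊗ x̂ i) ≤𝔾 g) → lhs ≤𝔾 g
      lhs-least p = G.⊔-lub (G.≤-respˡ-≈ (ext SupremumEquality.[ ⊗-identityʳ (head a) ]) (p zero))
        (G.foldr-≤ (ι -∞) lhs-terms (⊥±-minimum _)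
          λ k → ≡.subst (_≤𝔾 _) (≡.sym (ι-⊗ (a (suc k)) (x k))) (p (suc k)))

      ≤-lhs : ∀ i → ι (a i ⊗ x̂ i) ≤𝔾 lhs
      ≤-lhs zero    = G.≤-respˡ-≈ (G.Eq.sym (ext SupremumEquality.[ ⊗-identityʳ (head a) ]))
        (G.x≤x⊔y (ι (head a)) (foldr _⊕𝔾_ (ι -∞) lhs-terms))
      ≤-lhs (suc k) = ≡.subst (_≤𝔾 lhs) (ι-⊗ (a (suc k)) (x k))
        (G.trans (G.≤-foldr⁺ (ι -∞) lhs-terms k) (G.x≤y⊔x (ι (head a)) _))

    -- A maximum is below a bound when all its terms are, and in a total order a value below a
    -- maximum is below one of its terms. The constants are the terms at coordinate zero.
    satisfies⇔dominated : Satisfies x (inequality a b) ⇔ (∀ i → x ∈ Slice (Dominated (a i) i b))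
    satisfies⇔dominated = mk⇔
      (λ p i → let k , q = ≤-rhs⁻ (G.trans (≤-lhs i) p) in k , ≤𝔾⇒≤[] (a i ⊗ x̂ i) (b k) (x̂ k) q)
      (λ p → lhs-least λ i → let k , q = p i in
        G.trans (≤[]⇒≤𝔾 (a i ⊗ x̂ i) (b k) (x̂ k) q) (terms≤rhs k))

  -- A maximum of two coordinates equals one of them. Selecting at coordinate i on the left gives
  -- closure of the set under `⊞`; selecting at coordinate k on the right gives closure of its
  -- complement.
  dominated-isConicalHemispace : ∀ {n} a (i : Fin n) b → IsConicalHemispace (Dominated a i b)
  dominated-isConicalHemispace a i b = record
    { respects   = λ x≋y → λ { (k , p) → k , ≤[]-mono (b k)
                     (⊗-monoʳ a (ℝₘ.reflexive (ℝₘ.Eq.sym (x≋y i)))) (ℝₘ.reflexive (x≋y k)) p }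
    ; ⊙-closed   = λ s {x} → λ { (k , p) → k , ≤[]-mono (b k)
                     (ℝₘ.reflexive (⊗-swap a (fin s) (x i))) ℝₘ.refl
                     (≤[]-scale s {a ⊗ x i} {b k} {x k} p) }
    ; ⊞-closed   = λ {x} {y} → λ { (k , p) (l , q) →
        [ (λ e → k , ≤[]-mono (b k) (⊗-monoʳ a (ℝₘ.reflexive e)) (ℝₘ.x≤x⊔y (x k) (y k)) p)
        , (λ e → l , ≤[]-mono (b l) (⊗-monoʳ a (ℝₘ.reflexive e)) (ℝₘ.x≤y⊔x (x l) (y l)) q)
        ]′ (ℝₘ.⊔-sel (x i) (y i)) }
    ; ∁-⊞-closed = λ {x} {y} x∉ y∉ → λ { (k , p) →
        [ (λ e → x∉ (k , ≤[]-mono (b k) (⊗-monoʳ a (ℝₘ.x≤x⊔y (x i) (y i))) (ℝₘ.reflexive e) p))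
        , (λ e → y∉ (k , ≤[]-mono (b k) (⊗-monoʳ a (ℝₘ.x≤y⊔x (x i) (y i))) (ℝₘ.reflexive e) p))
        ]′ (ℝₘ.⊔-sel (x k) (y k)) }
    }

  -- The two translations and the equivalence.

  inequality-hemispaces : ∀ {n} (e : MixedInequality n) → ∃[ Hs ] (All IsHemispace Hs ×
    (∀ x → Satisfies x e ⇔ All (λ H → x ∈ pred H) Hs))
  inequality-hemispaces {n} e =
    tabulate slices , All.tabulate⁺ {f = slices} (λ i → slice-isHemispace (con i)) ,
    λ x → mk⇔ (All.tabulate⁺ {f = slices}) (All.tabulate⁻ {f = slices}) ⇔-∘ satisfies⇔dominated a b x
    where
    open MixedInequality e using (a₀; b₀)
    a = a₀ ∷ᵥ MixedInequality.a e
    b = b₀ ∷ᵥ MixedInequality.b e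

    con : ∀ i → IsConicalHemispace (Dominated (a i) i b)
    con i = dominated-isConicalHemispace (a i) i b

    slices : Fin (suc n) → Subset n
    slices i = slice (con i)

  -- One inequality per homogeneous coordinate j: the j-th unit vector as left coefficients isolates
  -- that coordinate.
  hemispace-inequalities : ∀ {n} (H : Subset n) → IsHemispace H →
    ∃[ es ] (∀ x → (x ∈ pred H) ⇔ All (Satisfies x) es)
  hemispace-inequalities {n} H H-hemi with hemispace-slice H H-hemi
  ... | A , A-con , H⇔A with ∈⇔inequalities A-con
  ...   | b , A⇔b = tabulate (λ j → inequality (unit j) (b j)) , λ x → mk⇔
    (λ x∈H → All.tabulate⁺ λ j → from (satisfies⇔dominated (unit j) (b j) x)
      (dominated x j (to (A⇔b ≡.refl) (to (H⇔A x) x∈H) j)))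
    (λ p → from (H⇔A x) (from (A⇔b ≡.refl) λ j →
      coordinate x j (to (satisfies⇔dominated (unit j) (b j) x) (All.tabulate⁻ {f = λ j → inequality (unit j) (b j)} p j) j)))
    where
    unit : Fin (suc n) → Vector ℝmax (suc n)
    unit j = single j (fin 0#)

    dominated : ∀ x j → ∃[ k ] homogeneous x j ≤[ b j k ] homogeneous x k →
                ∀ i → x ∈ Slice (Dominated (unit j i) i (b j))
    dominated x j (k , p) = single-elim (λ i s → x ∈ Slice (Dominated s i (b j))) j
      (k , ≤[]-mono (b j k) (ℝₘ.reflexive (⊗-identityˡ (homogeneous x j))) ℝₘ.refl p)
      -- Off j the left coefficient is -∞ and the condition is trivial; index zero is an arbitrary
      -- witness.
      (λ _ → zero , tt)

    coordinate : ∀ x j → x ∈ Slice (Dominated (unit j j) j (b j)) →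
                 ∃[ k ] homogeneous x j ≤[ b j k ] homogeneous x k
    coordinate x j (k , p) = k , ≤[]-mono (b j k) unit-⊗ ℝₘ.refl p
      where
      unit-⊗ : homogeneous x j ≤ₘ unit j j ⊗ homogeneous x j
      unit-⊗ rewrite updateAt-updates j {const (fin 0#)} (replicate (suc n) -∞) =
        ℝₘ.reflexive (ℝₘ.Eq.sym (⊗-identityˡ (homogeneous x j)))

  mixedPolyhedron⇔hemispaceIntersection : ∀ n (C : Subset n) →
    IsMixedPolyhedron C ⇔ IsHemispaceIntersection C
  mixedPolyhedron⇔hemispaceIntersection n C = mk⇔
    (λ { (es , C⇔es) →
      let Hs , hs , es⇔Hs = refine-All {G = λ _ → ⊤} (λ e _ → inequality-hemispaces e) es
                              (universal (λ _ → tt) es)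
      in Hs , hs , λ x → es⇔Hs x ⇔-∘ C⇔es x })
    (λ { (Hs , hs , C⇔Hs) →
      let es , _ , Hs⇔es = refine-All {K = λ _ → ⊤} {P = λ x H → x ∈ pred H}
                             (λ H h → let es , H⇔es = hemispace-inequalities H h in
                               es , universal (λ _ → tt) es , H⇔es) Hs hs
      in es , λ x → Hs⇔es x ⇔-∘ C⇔Hs x })

corollary17 : (∀ {ℓ} → ExcludedMiddle ℓ) → (R : RealField) → let open Tropical R in
    ∀ (n : ℕ) (C : Subset n) → IsMixedPolyhedron C ⇔ IsHemispaceIntersection C
corollary17 em R = Hemispace.mixedPolyhedron⇔hemispaceIntersection em R
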